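{- Let $L$ be a valid lattice and $t$ a tiling of $\mathbb{T}_L$ with flux $\varphi_t\in\mathscr{F}(L)$. Then $t$ admits no flips if and only if $\varphi_t\in\partial Q$, where $Q=\{(x,y)\in\mathbb{R}^2: |x|+|y|\le\frac12\}$ (i.e. if and only if $\varphi_t=(x,y)$ satisfies $|x|+|y|=\frac12$).
   Context: The unit square $[i,i+1]\times[j,j+1]$ ($i,j\in\mathbb{Z}$) is black if $i+j$ is even and white otherwise. A domino is the union of two unit squares sharing a side; a tiling of $\mathbb{Z}^2$ is a set of dominoes with pairwise disjoint interiors covering $\mathbb{R}^2$. Let $\mathscr{E}=2\mathbb{Z}^2$, $\mathscr{O}=2\mathbb{Z}^2+(1,1)$. A valid lattice is a subgroup $L\subset\mathbb{Z}^2$ generated by two linearly independent vectors in $\mathscr{E}\sqcup\mathscr{O}$. A tiling of $\mathbb{T}_L=\mathbb{R}^2/L$ is identified with an $L$-periodic tiling of $\mathbb{Z}^2$; it admits a flip if two parallel dominoes of the periodic tiling together form a $2\times2$ square. Height functions: each unit edge between neighboring points of $\mathbb{Z}^2$ is oriented so that the boundary of every black square is oriented clockwise. The height function $h_t:\mathbb{Z}^2\to\mathbb{Z}$ of a tiling $t$ satisfies $h_t(0)=0$ and, for every edge oriented from $u$ to $w$: $h_t(w)=h_t(u)+1$ if the edge is not the common side of the two squares of a domino of $t$, and $h_t(w)=h_t(u)-3$ otherwise. Flux: for a tiling $t$ of $\mathbb{T}_L$, $h_t(u+v)-h_t(u)$ depends only on $v\in L$ and is additive in $v$; the flux of $t$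 is the unique $\varphi_t\in\mathbb{R}^2$ with $4\langle\varphi_t,v\rangle=h_t(u+v)-h_t(u)$ for all $v\in L$, $u\in\mathbb{Z}^2$. $\mathscr{F}(L)$ is the set of fluxes of all tilings of $\mathbb{T}_L$; it is contained in $Q$. -}

module Defs where

open import Level using (0ℓ)
open import Data.Integer.Base using (ℤ; +_; 0ℤ; 1ℤ; -1ℤ; _+_; _-_; _*_)
open import Data.Integer.Divisibility using (_∣_)
open import Data.Rational.Base as ℚ using (ℚ; ½)
open import Data.Product.Base using (_×_; _,_; ∃-syntax; Σ-syntax)
open import Data.Product using (∃!)
open import Data.Sum.Base using (_⊎_)
open import Function.Bundles using (_⇔_)
open import Relation.Nullary.Negation using (¬_)
open import Relation.Unary using (Pred; _∈_; _∪_)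
open import Relation.Binary.PropositionalEquality using (_≡_)

ℤ² : Set
ℤ² = ℤ × ℤ

infixl 6 _⊕_
infixl 7 _⊙_

_⊕_ : ℤ² → ℤ² → ℤ²
(a , b) ⊕ (c , d) = (a + c , b + d)

_⊙_ : ℤ → ℤ² → ℤ²
k ⊙ (a , b) = (k * a , k * b)

origin : ℤ²
origin = (0ℤ , 0ℤ)

𝓔 𝓞 : Pred ℤ² 0ℓ
𝓔 v = ∃[ u ] v ≡ (+ 2) ⊙ u
𝓞 v = ∃[ u ] v ≡ (+ 2) ⊙ u ⊕ (1ℤ , 1ℤ)

-- For integer vectors, independence over ℤ and over ℝ coincide.
LinearlyIndependent : ℤ² → ℤ² → Set
LinearlyIndependent v w =
  ∀ (a b : ℤ) → a ⊙ v ⊕ b ⊙ w ≡ origin → a ≡ 0ℤ × b ≡ 0ℤ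

GeneratedBy : ℤ² → ℤ² → Pred ℤ² 0ℓ → Set
GeneratedBy v w L =
  ∀ (u : ℤ²) → u ∈ L ⇔ (Σ[ a ∈ ℤ ] Σ[ b ∈ ℤ ] u ≡ a ⊙ v ⊕ b ⊙ w)

IsValidLattice : Pred ℤ² 0ℓ → Set
IsValidLattice L =
  Σ[ v ∈ ℤ² ] Σ[ w ∈ ℤ² ]
    v ∈ 𝓔 ∪ 𝓞 × w ∈ 𝓔 ∪ 𝓞 × LinearlyIndependent v w × GeneratedBy v w L

-- The square [i,i+1]×[j,j+1] is named by its lower-left corner (i , j).
Square : Set
Square = ℤ²

Black : Pred Square 0ℓ
Black (i , j) = + 2 ∣ i + j

-- hor s is the union of s and the square to its right,
-- ver s the union of s and the square above it.
data Domino : Set where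
  hor ver : Square → Domino

data Side : Set where
  left top right bottom : Side

neighbour : Square → Side → Square
neighbour s left   = s ⊕ (-1ℤ , 0ℤ)
neighbour s top    = s ⊕ (0ℤ , 1ℤ)
neighbour s right  = s ⊕ (1ℤ , 0ℤ)
neighbour s bottom = s ⊕ (0ℤ , -1ℤ)

infix 4 _covers_

_covers_ : Domino → Square → Set
hor s covers q = q ≡ s ⊎ q ≡ neighbour s right
ver s covers q = q ≡ s ⊎ q ≡ neighbour s top

translate : ℤ² → Domino → Domino
translate v (hor s) = hor (s ⊕ v)
translate v (ver s) = ver (s ⊕ v)

-- Dominoes are unions of unit squares, so they cover the plane with disjoint
-- interiors exactly when each unit square lies in exactly one of them.
IsTiling : Pred Domino 0ℓ → Set
IsTiling t = ∀ (q : Square) → ∃! _≡_ λ d → d ∈ t × d covers q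

IsPeriodic : Pred ℤ² 0ℓ → Pred Domino 0ℓ → Set
IsPeriodic L t = ∀ (v : ℤ²) → v ∈ L → ∀ (d : Domino) → d ∈ t ⇔ translate v d ∈ t

IsTorusTiling : Pred ℤ² 0ℓ → Pred Domino 0ℓ → Set
IsTorusTiling L t = IsTiling t × IsPeriodic L t

AdmitsFlip : Pred Domino 0ℓ → Set
AdmitsFlip t = Σ[ s ∈ Square ]
  ( (hor s ∈ t × hor (neighbour s top) ∈ t)
  ⊎ (ver s ∈ t × ver (neighbour s right) ∈ t) )

-- The sides of a square, each directed clockwise around it.  Every unit edge
-- of ℤ² is a side of exactly one black square.
source target : Square → Side → ℤ²
source s left   = s
source s top    = s ⊕ (0ℤ , 1ℤ)
source s right  = s ⊕ (1ℤ , 1ℤ)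
source s bottom = s ⊕ (1ℤ , 0ℤ)

target s left   = s ⊕ (0ℤ , 1ℤ)
target s top    = s ⊕ (1ℤ , 1ℤ)
target s right  = s ⊕ (1ℤ , 0ℤ)
target s bottom = s

Crossed : Pred Domino 0ℓ → Square → Side → Set
Crossed t s e = Σ[ d ∈ Domino ] d ∈ t × d covers s × d covers neighbour s e

IsHeightFunction : Pred Domino 0ℓ → (ℤ² → ℤ) → Set
IsHeightFunction t h =
  h origin ≡ 0ℤ ×
  (∀ (s : Square) → s ∈ Black → ∀ (e : Side) →
     (¬ Crossed t s e → h (target s e) ≡ h (source s e) + 1ℤ) ×
     (Crossed t s e → h (target s e) ≡ h (source s e) - + 3))

ℚ² : Set
ℚ² = ℚ × ℚ

fromℤ : ℤ → ℚ
fromℤ n = n ℚ./ 1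

⟨_,_⟩ : ℚ² → ℤ² → ℚ
⟨ (x , y) , (a , b) ⟩ = x ℚ.* fromℤ a ℚ.+ y ℚ.* fromℤ b

-- The flux solves a nonsingular integer linear system (one equation for each
-- generator of L), so it is always a rational vector.
IsFlux : Pred ℤ² 0ℓ → (ℤ² → ℤ) → ℚ² → Set
IsFlux L h φ =
  ∀ (v : ℤ²) → v ∈ L → ∀ (u : ℤ²) →
    fromℤ (+ 4) ℚ.* ⟨ φ , v ⟩ ≡ fromℤ (h (u ⊕ v) - h u)

-- The boundary of Q = { (x , y) : |x| + |y| ≤ ½ }, at rational points.
∂Q : Pred ℚ² 0ℓ
∂Q (x , y) = ℚ.∣ x ∣ ℚ.+ ℚ.∣ y ∣ ≡ ½

{-# OPTIONS --safe #-}

-- Edges leave an even vertex (one with even coordinate sum) vertically and an odd vertex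
-- horizontally, so a diagonal step (±1 , ±1) from an even vertex follows two oriented edges
-- and raises h by at most 2.  Moving along a multiple of such a step that lies in L gives
-- |x| + |y| ≤ ½ for the flux (x , y).  If equality holds, every step in some direction
-- (σ , τ) raises h by exactly 2; then no black square is matched across one of its two
-- vertical sides, nor across one of its two horizontal sides.  A flip would need both
-- vertical or both horizontal sides.  Conversely, without flips h has no local maximum, so
-- each even vertex has a diagonal step raising h by exactly 2.  A path of such steps
-- repeats a residue modulo the determinant of L after some k > 0 steps: this yields v ∈ L with sup norm at
-- most k along which h rises by 2k, whence 2k ≤ 4k (|x| + |y|).

module Submission where

open import Defs
open import Algebra.Properties.Group using (∙-cancelˡ)
open import Level using (0ℓ)
open import Data.Bool.Base using (Bool; false; true)
open import Data.Fin.Base using (Fin; toℕ; fromℕ<; combine)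
import Data.Fin.Properties as Fin
open import Data.Integer.Base using (ℤ; +_; -[1+_]; 0ℤ; 1ℤ; -1ℤ; _+_; _-_; _*_; -_; _/_; _%_; ∣_∣; _◃_; _≤_; +≤+; -≤+; -<+; NonZero; ≢-nonZero)
open import Data.Integer.Divisibility using (_∣_)
open import Data.Integer.Divisibility.Signed using (divides; ∣ᵤ⇒∣; ∣⇒∣ᵤ; ∣m∣n⇒∣m+n)
import Data.Integer.DivMod as ℤ
import Data.Integer.Properties as ℤ
open import Data.Integer.Tactic.RingSolver using (solve-∀)
open import Data.Nat.Base as ℕ using (ℕ; zero; suc)
import Data.Nat.Divisibility as ℕ
import Data.Nat.Properties as ℕ
open import Data.Product.Base using (_×_; _,_; proj₁; proj₂; Σ-syntax; ∃-syntax; ∃₂)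
open import Data.Product.Properties using (≡-dec)
open import Data.Rational.Base as ℚ using (ℚ; ½; toℚᵘ)
import Data.Rational.Properties as ℚ
open import Data.Rational.Unnormalised.Base as ℚᵘ using (mkℚᵘ; *≤*; *≡*)
import Data.Rational.Unnormalised.Properties as ℚᵘ
open import Data.Sign.Base as Sign using (Sign)
open import Data.Sum.Base using (_⊎_; inj₁; inj₂)
open import Function.Base using (_∘_; _$_)
open import Function.Bundles using (_⇔_; mk⇔; Equivalence)
open import Relation.Binary.Definitions using (DecidableEquality)
open import Relation.Binary.PropositionalEquality using (_≡_; _≢_; refl; sym; trans; cong; cong₂; subst; subst₂; module ≡-Reasoning)
open import Relation.Nullary.Decidable using (Dec; yes; no; map′; _⊎-dec_)
open import Relation.Nullary.Negation using (¬_; contradiction)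
open import Relation.Unary using (Pred; _∈_)

-- Integer vectors and parity

⊕-assoc : ∀ u v w → u ⊕ v ⊕ w ≡ u ⊕ (v ⊕ w)
⊕-assoc (a , b) (c , d) (e , f) = cong₂ _,_ (ℤ.+-assoc a c e) (ℤ.+-assoc b d f)

⊕-identityʳ : ∀ u → u ⊕ origin ≡ u
⊕-identityʳ (a , b) = cong₂ _,_ (ℤ.+-identityʳ a) (ℤ.+-identityʳ b)

⊕-suc : ∀ u n v → u ⊕ (+ suc n) ⊙ v ≡ u ⊕ v ⊕ (+ n) ⊙ v
⊕-suc (a , b) n (c , d) = cong₂ _,_ (expand a (+ n) c) (expand b (+ n) d)
  where
  expand : ∀ a n c → a + (1ℤ + n) * c ≡ a + c + n * c
  expand = solve-∀

+-cancelˡ : ∀ (a b c : ℤ) → a + b ≡ a + c → b ≡ c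
+-cancelˡ = ∙-cancelˡ (record { isGroup = ℤ.+-0-isGroup })

i+j-i≡j : ∀ i j → i + j - i ≡ j
i+j-i≡j = solve-∀

⊕-cancelˡ : ∀ u {v w} → u ⊕ v ≡ u ⊕ w → v ≡ w
⊕-cancelˡ (a , b) eq =
  cong₂ _,_ (+-cancelˡ a _ _ (cong proj₁ eq)) (+-cancelˡ b _ _ (cong proj₂ eq))

infix 4 _≟²_

_≟²_ : DecidableEquality ℤ²
_≟²_ = ≡-dec ℤ._≟_ ℤ._≟_

black-⊕ : ∀ u c → Black c → Black u → Black (u ⊕ c)
black-⊕ (a , b) (c , d) pc pu = subst (+ 2 ∣_) (interchange a b c d) $
  ∣⇒∣ᵤ {+ 2} (∣m∣n⇒∣m+n {+ 2} (∣ᵤ⇒∣ {+ 2} {a + b} pu) (∣ᵤ⇒∣ {+ 2} {c + d} pc))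
  where
  interchange : ∀ a b c d → (a + b) + (c + d) ≡ (a + c) + (b + d)
  interchange = solve-∀

black-⊕⊕ : ∀ u c d → Black (c ⊕ d) → Black u → Black (u ⊕ c ⊕ d)
black-⊕⊕ u c d pcd pu = subst Black (sym (⊕-assoc u c d)) (black-⊕ u (c ⊕ d) pcd pu)

black-or-right-black : ∀ s → Black s ⊎ Black (s ⊕ (1ℤ , 0ℤ))
black-or-right-black (a , b) with (a + b) ℤ.%ℕ 2 in eq | ℤ.n%ℕd<d (a + b) 2
... | 0 | _ = inj₁ (∣⇒∣ᵤ {+ 2} {a + b} (divides q (trans decompose (ℤ.+-identityˡ (q * + 2)))))
  where
  q = (a + b) ℤ./ℕ 2
  decompose : a + b ≡ + 0 + q * + 2
  decompose = subst (λ r → a + b ≡ + r + q * + 2) eq (ℤ.a≡a%ℕn+[a/ℕn]*n (a + b) 2)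
... | 1 | _ = inj₂ (∣⇒∣ᵤ {+ 2} {(a + 1ℤ) + (b + 0ℤ)} (divides (q + 1ℤ) (begin
    (a + 1ℤ) + (b + 0ℤ)    ≡⟨ regroup a b ⟩
    (a + b) + 1ℤ           ≡⟨ cong (_+ 1ℤ) decompose ⟩
    (1ℤ + q * + 2) + 1ℤ    ≡⟨ collect q ⟩
    (q + 1ℤ) * + 2         ∎)))
  where
  open ≡-Reasoning
  q = (a + b) ℤ./ℕ 2
  decompose : a + b ≡ + 1 + q * + 2
  decompose = subst (λ r → a + b ≡ + r + q * + 2) eq (ℤ.a≡a%ℕn+[a/ℕn]*n (a + b) 2)
  regroup : ∀ a b → (a + 1ℤ) + (b + 0ℤ) ≡ (a + b) + 1ℤ
  regroup = solve-∀
  collect : ∀ q → (1ℤ + q * + 2) + 1ℤ ≡ (q + 1ℤ) * + 2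
  collect = solve-∀
... | suc (suc _) | ℕ.s≤s (ℕ.s≤s ())

-- Sides of squares and the dominoes lying across them

across along : Side → ℤ²
across left   = (-1ℤ , 0ℤ)
across top    = (0ℤ , 1ℤ)
across right  = (1ℤ , 0ℤ)
across bottom = (0ℤ , -1ℤ)
along left   = (0ℤ , 1ℤ)
along top    = (1ℤ , 0ℤ)
along right  = (0ℤ , -1ℤ)
along bottom = (-1ℤ , 0ℤ)

neighbour-⊕ : ∀ s e → neighbour s e ≡ s ⊕ across e
neighbour-⊕ s left   = refl
neighbour-⊕ s top    = refl
neighbour-⊕ s right  = refl
neighbour-⊕ s bottom = refl

target≡source⊕along : ∀ s e → target s e ≡ source s e ⊕ along e
target≡source⊕along s left   = refl
target≡source⊕along s top    = sym (⊕-assoc s _ _)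
target≡source⊕along s right  = sym (⊕-assoc s _ _)
target≡source⊕along s bottom = sym (trans (⊕-assoc s _ _) (⊕-identityʳ s))

-- The square whose side `e` starts at `p`. It inverts `source`, so that the edge conditions on the
-- height, which are indexed by squares, can be read from a vertex.
squareFrom : ℤ² → Side → Square
squareFrom p left   = p
squareFrom p top    = p ⊕ (0ℤ , -1ℤ)
squareFrom p right  = p ⊕ (-1ℤ , -1ℤ)
squareFrom p bottom = p ⊕ (-1ℤ , 0ℤ)

source-squareFrom : ∀ p e → source (squareFrom p e) e ≡ p
source-squareFrom p left   = refl
source-squareFrom p top    = trans (⊕-assoc p _ _) (⊕-identityʳ p)
source-squareFrom p right  = trans (⊕-assoc p _ _) (⊕-identityʳ p)
source-squareFrom p bottom = trans (⊕-assoc p _ _) (⊕-identityʳ p)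

target-squareFrom : ∀ p e → target (squareFrom p e) e ≡ p ⊕ along e
target-squareFrom p e =
  trans (target≡source⊕along (squareFrom p e) e) (cong (_⊕ along e) (source-squareFrom p e))

corner : Domino → Square
corner (hor s) = s
corner (ver s) = s

indicator : Bool → ℤ
indicator false = 0ℤ
indicator true  = 1ℤ

-- The offset of either square of a domino from its corner. With the two squares addressed by a
-- Boolean, questions about coverage become finite checks on small vectors.
cell : Domino → Bool → ℤ²
cell (hor _) b = (indicator b , 0ℤ)
cell (ver _) b = (0ℤ , indicator b)

covers⇒cell : ∀ d {q} → d covers q → ∃[ b ] q ≡ corner d ⊕ cell d b
covers⇒cell (hor s) (inj₁ refl) = false , sym (⊕-identityʳ s)
covers⇒cell (hor s) (inj₂ refl) = true , refl
covers⇒cell (ver s) (inj₁ refl) = false , sym (⊕-identityʳ s)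
covers⇒cell (ver s) (inj₂ refl) = true , refl

-- The only domino that can contain both squares at the side `e` of `s`. It replaces the existential
-- in `Crossed` by membership of one explicit domino.
bridge : Square → Side → Domino
bridge s left   = hor (s ⊕ (-1ℤ , 0ℤ))
bridge s top    = ver s
bridge s right  = hor s
bridge s bottom = ver (s ⊕ (0ℤ , -1ℤ))

-- The corner has already been cancelled from the hypothesis, so it compares closed vectors: four
-- combinations are possible and the others are refuted by computation.
cells⇒bridge : ∀ d e a b → cell d a ⊕ across e ≡ cell d b → bridge (corner d ⊕ cell d a) e ≡ d
cells⇒bridge (hor s) left   true  false refl = cong hor (trans (⊕-assoc s _ _) (⊕-identityʳ s))
cells⇒bridge (hor s) right  false true  refl = cong hor (⊕-identityʳ s)
cells⇒bridge (ver s) bottom true  false refl = cong ver (trans (⊕-assoc s _ _) (⊕-identityʳ s))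
cells⇒bridge (ver s) top    false true  refl = cong ver (⊕-identityʳ s)
cells⇒bridge (hor _) left   false false ()
cells⇒bridge (hor _) left   false true  ()
cells⇒bridge (hor _) right  true  false ()
cells⇒bridge (hor _) right  true  true  ()
cells⇒bridge (hor _) top    _     _     ()
cells⇒bridge (hor _) bottom _     _     ()
cells⇒bridge (ver _) bottom false false ()
cells⇒bridge (ver _) bottom false true  ()
cells⇒bridge (ver _) top    true  false ()
cells⇒bridge (ver _) top    true  true  ()
cells⇒bridge (ver _) left   _     _     ()
cells⇒bridge (ver _) right  _     _     ()

covers-both⇒bridge : ∀ d s e → d covers s → d covers neighbour s e → bridge s e ≡ d
covers-both⇒bridge d s e ds dn with covers⇒cell d ds | covers⇒cell d dn
... | a , refl | b , eq = cells⇒bridge d e a b $ ⊕-cancelˡ (corner d) $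
  trans (sym (⊕-assoc (corner d) _ _)) (trans (sym (neighbour-⊕ _ e)) eq)

_covers?_ : ∀ d q → Dec (d covers q)
hor s covers? q = (q ≟² s) ⊎-dec (q ≟² neighbour s right)
ver s covers? q = (q ≟² s) ⊎-dec (q ≟² neighbour s top)

-- Diagonal steps as two oriented edges

-- The sign is the direction of the side when traversed clockwise.  Below, Black u also serves
-- as evenness of a vertex u.
vertical horizontal : Sign → Side
vertical Sign.+ = left
vertical Sign.- = right
horizontal Sign.+ = top
horizontal Sign.- = bottom

diagonal : Sign → Sign → ℤ²
diagonal σ τ = (σ ◃ 1 , τ ◃ 1)

-- The vertical edge comes first because orientations leave even vertices vertically; the vertex in
-- the middle is then odd and is left horizontally.
along-vertical-horizontal : ∀ u σ τ → u ⊕ along (vertical τ) ⊕ along (horizontal σ) ≡ u ⊕ diagonal σ τ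
along-vertical-horizontal u Sign.+ Sign.+ = ⊕-assoc u _ _
along-vertical-horizontal u Sign.+ Sign.- = ⊕-assoc u _ _
along-vertical-horizontal u Sign.- Sign.+ = ⊕-assoc u _ _
along-vertical-horizontal u Sign.- Sign.- = ⊕-assoc u _ _

black-diagonal : ∀ u σ τ → Black u → Black (u ⊕ diagonal σ τ)
black-diagonal u σ τ = black-⊕ u (diagonal σ τ) (even σ τ)
  where
  even : ∀ σ τ → Black (diagonal σ τ)
  even Sign.+ Sign.+ = ℕ.divides 1 refl
  even Sign.+ Sign.- = ℕ.divides 0 refl
  even Sign.- Sign.+ = ℕ.divides 0 refl
  even Sign.- Sign.- = ℕ.divides 1 refl

-- Both vertical edges at an even vertex are oriented away from it, the upward one by the black
-- square `u` and the downward one by the black square diagonally below.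
black-squareFrom-vertical : ∀ u τ → Black u → Black (squareFrom u (vertical τ))
black-squareFrom-vertical u Sign.+ pu = pu
black-squareFrom-vertical u Sign.- pu = black-⊕ u (-1ℤ , -1ℤ) (ℕ.divides 1 refl) pu

black-squareFrom-horizontal : ∀ u τ σ → Black u →
  Black (squareFrom (u ⊕ along (vertical τ)) (horizontal σ))
black-squareFrom-horizontal u Sign.+ Sign.+ = black-⊕⊕ u _ (0ℤ , -1ℤ) (ℕ.divides 0 refl)
black-squareFrom-horizontal u Sign.+ Sign.- = black-⊕⊕ u _ (-1ℤ , 0ℤ) (ℕ.divides 0 refl)
black-squareFrom-horizontal u Sign.- Sign.+ = black-⊕⊕ u _ (0ℤ , -1ℤ) (ℕ.divides 1 refl)
black-squareFrom-horizontal u Sign.- Sign.- = black-⊕⊕ u _ (-1ℤ , 0ℤ) (ℕ.divides 1 refl)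

squareFrom-source : ∀ s e → squareFrom (source s e) e ≡ s
squareFrom-source s left   = refl
squareFrom-source s top    = trans (⊕-assoc s _ _) (⊕-identityʳ s)
squareFrom-source s right  = trans (⊕-assoc s _ _) (⊕-identityʳ s)
squareFrom-source s bottom = trans (⊕-assoc s _ _) (⊕-identityʳ s)

black-source-vertical : ∀ s τ → Black s → Black (source s (vertical τ))
black-source-vertical s Sign.+ ps = ps
black-source-vertical s Sign.- ps = black-⊕ s (1ℤ , 1ℤ) (ℕ.divides 1 refl) ps

-- The vertex `u` is found by undoing the vertical edge of direction `τ`. Any horizontal side of a
-- black square thus becomes the second edge of a diagonal step with a prescribed `τ`.
source-horizontal : ∀ s σ τ → Black s →
  ∃[ u ] Black u × source s (horizontal σ) ≡ u ⊕ along (vertical τ)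
source-horizontal s Sign.+ Sign.+ ps = s , ps , refl
source-horizontal s Sign.+ Sign.- ps =
  s ⊕ (0ℤ , + 2) , black-⊕ s (0ℤ , + 2) (ℕ.divides 1 refl) ps , sym (⊕-assoc s _ _)
source-horizontal s Sign.- Sign.+ ps =
  s ⊕ (1ℤ , -1ℤ) , black-⊕ s (1ℤ , -1ℤ) (ℕ.divides 0 refl) ps , sym (⊕-assoc s _ _)
source-horizontal s Sign.- Sign.- ps =
  s ⊕ (1ℤ , 1ℤ) , black-⊕ s (1ℤ , 1ℤ) (ℕ.divides 1 refl) ps , sym (⊕-assoc s _ _)

bridge-covers : ∀ s e → bridge s e covers s × bridge s e covers neighbour s e
bridge-covers s left   =
  inj₂ (sym (trans (⊕-assoc s _ _) (⊕-identityʳ s))) , inj₁ refl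
bridge-covers s top    = inj₁ refl , inj₂ refl
bridge-covers s right  = inj₁ refl , inj₂ refl
bridge-covers s bottom =
  inj₂ (sym (trans (⊕-assoc s _ _) (⊕-identityʳ s))) , inj₁ refl

-- Crossed sides and flips

module _ {t : Pred Domino 0ℓ} where

  crossed⇒bridge : ∀ {s} e → Crossed t s e → bridge s e ∈ t
  crossed⇒bridge {s} e (d , d∈t , ds , dn) =
    subst t (sym (covers-both⇒bridge d s e ds dn)) d∈t

  bridge⇒crossed : ∀ s e → bridge s e ∈ t → Crossed t s e
  bridge⇒crossed s e b∈t = bridge s e , b∈t , bridge-covers s e

  -- Membership in `t` need not be decidable, but the tiling supplies the unique domino covering
  -- `s`, and only that domino has to be tested against the neighbour.
  crossed? : IsTiling t → ∀ s e → Dec (Crossed t s e)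
  crossed? tiling s e with tiling s
  ... | d , (d∈t , ds) , unique = map′
    (λ dn → d , d∈t , ds , dn)
    (λ { (d′ , d′∈t , d′s , d′n) →
         subst (_covers neighbour s e) (sym (unique (d′∈t , d′s))) d′n })
    (d covers? neighbour s e)

  -- The two sides are the upward and downward edges at `u`; the horizontal dominoes across them
  -- fill the block of four squares centred at `u`.
  flip-vertical : ∀ u →
    Crossed t (squareFrom u left) left → Crossed t (squareFrom u right) right → AdmitsFlip t
  flip-vertical u cl cr = u ⊕ (-1ℤ , -1ℤ) , inj₁
    ( crossed⇒bridge right cr
    , subst (λ s → hor s ∈ t) (sym (⊕-assoc u _ _)) (crossed⇒bridge left cl))

  flip-horizontal : ∀ w →
    Crossed t (squareFrom w top) top → Crossed t (squareFrom w bottom) bottom → AdmitsFlip t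
  flip-horizontal w ct cb = w ⊕ (-1ℤ , -1ℤ) , inj₂
    ( subst (λ s → ver s ∈ t) (⊕-assoc w _ _) (crossed⇒bridge bottom cb)
    , subst (λ s → ver s ∈ t) (sym (⊕-assoc w _ _)) (crossed⇒bridge top ct))

  -- Of the squares s and s ⊕ (1 , 0) exactly one is black, so the parallel dominoes
  -- of a flip leave their black squares in opposite directions.
  flip⇒opposite-crossings : AdmitsFlip t →
    (∀ ρ → ∃[ s ] Black s × Crossed t s (vertical ρ)) ⊎
    (∀ ρ → ∃[ s ] Black s × Crossed t s (horizontal ρ))
  flip⇒opposite-crossings (s , inj₁ (hs , ht)) = inj₁ crossing
    where
    crossing : ∀ ρ → ∃[ s ] Black s × Crossed t s (vertical ρ)
    crossing ρ with black-or-right-black s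
    crossing Sign.+ | inj₁ ps = s ⊕ (1ℤ , 1ℤ) , black-⊕ s (1ℤ , 1ℤ) (ℕ.divides 1 refl) ps ,
      bridge⇒crossed _ left (subst (λ s → hor s ∈ t) (sym (⊕-assoc s _ _)) ht)
    crossing Sign.- | inj₁ ps = s , ps , bridge⇒crossed s right hs
    crossing Sign.+ | inj₂ ps = s ⊕ (1ℤ , 0ℤ) , ps , bridge⇒crossed _ left
      (subst (λ s → hor s ∈ t) (sym (trans (⊕-assoc s _ _) (⊕-identityʳ s))) hs)
    crossing Sign.- | inj₂ ps = s ⊕ (0ℤ , 1ℤ) ,
      subst Black (⊕-assoc s _ _) (black-⊕ (s ⊕ (1ℤ , 0ℤ)) (-1ℤ , 1ℤ) (ℕ.divides 0 refl) ps) ,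
      bridge⇒crossed _ right ht
  flip⇒opposite-crossings (s , inj₂ (vs , vr)) = inj₂ crossing
    where
    crossing : ∀ ρ → ∃[ s ] Black s × Crossed t s (horizontal ρ)
    crossing ρ with black-or-right-black s
    crossing Sign.+ | inj₁ ps = s , ps , bridge⇒crossed s top vs
    crossing Sign.- | inj₁ ps = s ⊕ (1ℤ , 1ℤ) , black-⊕ s (1ℤ , 1ℤ) (ℕ.divides 1 refl) ps ,
      bridge⇒crossed _ bottom (subst (λ s → ver s ∈ t) (sym (⊕-assoc s _ _)) vr)
    crossing Sign.+ | inj₂ ps = s ⊕ (1ℤ , 0ℤ) , ps , bridge⇒crossed _ top vr
    crossing Sign.- | inj₂ ps = s ⊕ (0ℤ , 1ℤ) ,
      subst Black (⊕-assoc s _ _) (black-⊕ (s ⊕ (1ℤ , 0ℤ)) (-1ℤ , 1ℤ) (ℕ.divides 0 refl) ps) ,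
      bridge⇒crossed _ bottom
        (subst (λ s → ver s ∈ t) (sym (trans (⊕-assoc s _ _) (⊕-identityʳ s))) vs)

-- Height changes along edges and diagonal steps

module Height (t : Pred Domino 0ℓ) (tiling : IsTiling t)
              (h : ℤ² → ℤ) (height : IsHeightFunction t h) where

  uncrossed-edge : ∀ p e → Black (squareFrom p e) → ¬ Crossed t (squareFrom p e) e →
    h (p ⊕ along e) ≡ h p + 1ℤ
  uncrossed-edge p e black ¬c = subst₂ (λ x y → h x ≡ h y + 1ℤ)
    (target-squareFrom p e) (source-squareFrom p e) (proj₁ (proj₂ height _ black e) ¬c)

  crossed-edge : ∀ p e → Black (squareFrom p e) → Crossed t (squareFrom p e) e →
    h (p ⊕ along e) ≡ h p - + 3
  crossed-edge p e black c = subst₂ (λ x y → h x ≡ h y - + 3)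
    (target-squareFrom p e) (source-squareFrom p e) (proj₂ (proj₂ height _ black e) c)

  edge-≤ : ∀ p e → Black (squareFrom p e) → h (p ⊕ along e) ≤ h p + 1ℤ
  edge-≤ p e black with crossed? tiling (squareFrom p e) e
  ... | no  ¬c = ℤ.≤-reflexive (uncrossed-edge p e black ¬c)
  ... | yes c  = ℤ.≤-trans (ℤ.≤-reflexive (crossed-edge p e black c)) (ℤ.+-monoʳ-≤ (h p) -≤+)

  module _ (u : ℤ²) (black : Black u) where

    vertical-≤ : ∀ τ → h (u ⊕ along (vertical τ)) ≤ h u + 1ℤ
    vertical-≤ τ = edge-≤ u (vertical τ) (black-squareFrom-vertical u τ black)

    horizontal-≤ : ∀ σ τ → let w = u ⊕ along (vertical τ) in
      h (w ⊕ along (horizontal σ)) ≤ h w + 1ℤ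
    horizontal-≤ σ τ = edge-≤ _ (horizontal σ) (black-squareFrom-horizontal u τ σ black)

    diagonal-≤ : ∀ σ τ → h (u ⊕ diagonal σ τ) ≤ h u + + 2
    diagonal-≤ σ τ = begin
      h (u ⊕ diagonal σ τ)                                ≡⟨ cong h (along-vertical-horizontal u σ τ) ⟨
      h (u ⊕ along (vertical τ) ⊕ along (horizontal σ))   ≤⟨ horizontal-≤ σ τ ⟩
      h (u ⊕ along (vertical τ)) + 1ℤ                     ≤⟨ ℤ.+-monoˡ-≤ 1ℤ (vertical-≤ τ) ⟩
      h u + 1ℤ + 1ℤ                                       ≡⟨ ℤ.+-assoc (h u) 1ℤ 1ℤ ⟩
      h u + + 2                                           ∎
      where open ℤ.≤-Reasoning

    -- A crossed edge loses 3 and the other edge gains at most 1, so one crossing on a diagonal step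
    -- rules out the maximal rise of 2.
    crossed-vertical : ∀ σ τ → Crossed t (squareFrom u (vertical τ)) (vertical τ) →
      h (u ⊕ diagonal σ τ) ≤ h u - + 2
    crossed-vertical σ τ c = begin
      h (u ⊕ diagonal σ τ)                                ≡⟨ cong h (along-vertical-horizontal u σ τ) ⟨
      h (u ⊕ along (vertical τ) ⊕ along (horizontal σ))   ≤⟨ horizontal-≤ σ τ ⟩
      h (u ⊕ along (vertical τ)) + 1ℤ                     ≡⟨ cong (_+ 1ℤ)
        (crossed-edge u (vertical τ) (black-squareFrom-vertical u τ black) c) ⟩
      h u - + 3 + 1ℤ                                      ≡⟨ ℤ.+-assoc (h u) _ _ ⟩
      h u - + 2                                           ∎
      where open ℤ.≤-Reasoning

    crossed-horizontal : ∀ σ τ →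
      Crossed t (squareFrom (u ⊕ along (vertical τ)) (horizontal σ)) (horizontal σ) →
      h (u ⊕ diagonal σ τ) ≤ h u - + 2
    crossed-horizontal σ τ c = begin
      h (u ⊕ diagonal σ τ)                                ≡⟨ cong h (along-vertical-horizontal u σ τ) ⟨
      h (u ⊕ along (vertical τ) ⊕ along (horizontal σ))   ≡⟨
        crossed-edge _ (horizontal σ) (black-squareFrom-horizontal u τ σ black) c ⟩
      h (u ⊕ along (vertical τ)) - + 3                    ≤⟨ ℤ.+-monoˡ-≤ _ (vertical-≤ τ) ⟩
      h u + 1ℤ - + 3                                      ≡⟨ ℤ.+-assoc (h u) _ _ ⟩
      h u - + 2                                           ∎
      where open ℤ.≤-Reasoning

    -- If both vertical edges leaving `u` were crossed, their dominoes would form a flip around `u`,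
    -- so one is uncrossed. The same holds for the horizontal edges leaving the odd vertex reached,
    -- and two uncrossed edges gain 2.
    climb : ¬ AdmitsFlip t → ∃₂ λ σ τ → h (u ⊕ diagonal σ τ) ≡ h u + + 2
    climb ¬flip = σ , τ , (begin
      h (u ⊕ diagonal σ τ)                                ≡⟨ cong h (along-vertical-horizontal u σ τ) ⟨
      h (w ⊕ along (horizontal σ))                        ≡⟨
        uncrossed-edge w (horizontal σ) (black-squareFrom-horizontal u τ σ black) (proj₂ uncrossed-h) ⟩
      h w + 1ℤ                                            ≡⟨ cong (_+ 1ℤ)
        (uncrossed-edge u (vertical τ) (black-squareFrom-vertical u τ black) (proj₂ uncrossed-v)) ⟩
      h u + 1ℤ + 1ℤ                                       ≡⟨ ℤ.+-assoc (h u) 1ℤ 1ℤ ⟩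
      h u + + 2                                           ∎)
      where
      open ≡-Reasoning
      uncrossed-v : ∃[ τ ] ¬ Crossed t (squareFrom u (vertical τ)) (vertical τ)
      uncrossed-v with crossed? tiling (squareFrom u left) left
      ... | no ¬c = Sign.+ , ¬c
      ... | yes c = Sign.- , ¬flip ∘ flip-vertical u c
      τ = proj₁ uncrossed-v
      w = u ⊕ along (vertical τ)
      uncrossed-h : ∃[ σ ] ¬ Crossed t (squareFrom w (horizontal σ)) (horizontal σ)
      uncrossed-h with crossed? tiling (squareFrom w top) top
      ... | no ¬c = Sign.+ , ¬c
      ... | yes c = Sign.- , ¬flip ∘ flip-horizontal w c
      σ = proj₁ uncrossed-h

  -- A flip provides crossings in both directions of one axis, hence one in the direction used by
  -- the step `diagonal σ τ`, as its first or its second edge. That step then falls by at least 2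
  -- instead of rising.
  steep⇒no-flip : ∀ σ τ → (∀ u → Black u → h u + + 2 ≤ h (u ⊕ diagonal σ τ)) → ¬ AdmitsFlip t
  steep⇒no-flip σ τ steep flip with flip⇒opposite-crossings flip
  ... | inj₁ crossings with s , black , c ← crossings τ =
    let u       = source s (vertical τ)
        black-u = black-source-vertical s τ black
        c′      = subst (λ s → Crossed t s (vertical τ)) (sym (squareFrom-source s (vertical τ))) c
    in ℤ.<⇒≱ (ℤ.+-monoʳ-< (h u) -<+) (ℤ.≤-trans (steep u black-u) (crossed-vertical u black-u σ τ c′))
  ... | inj₂ crossings with s , black , c ← crossings σ =
    let u , black-u , eq = source-horizontal s σ τ black
        s≡ = trans (cong (λ p → squareFrom p (horizontal σ)) (sym eq)) (squareFrom-source s (horizontal σ))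
        c′ = subst (λ s → Crossed t s (horizontal σ)) (sym s≡) c
    in ℤ.<⇒≱ (ℤ.+-monoʳ-< (h u) -<+) (ℤ.≤-trans (steep u black-u) (crossed-horizontal u black-u σ τ c′))

  diagonal-≤-iterate : ∀ σ τ n u → Black u →
    h (u ⊕ (+ n) ⊙ diagonal σ τ) ≤ h u + + 2 * + n
  diagonal-≤-iterate σ τ zero u black = ℤ.≤-reflexive
    (trans (cong h (⊕-identityʳ u)) (sym (ℤ.+-identityʳ (h u))))
  diagonal-≤-iterate σ τ (suc n) u black = begin
    h (u ⊕ (+ suc n) ⊙ diagonal σ τ)                  ≡⟨ cong h (⊕-suc u n (diagonal σ τ)) ⟩
    h (u ⊕ diagonal σ τ ⊕ (+ n) ⊙ diagonal σ τ)       ≤⟨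
      diagonal-≤-iterate σ τ n (u ⊕ diagonal σ τ) (black-diagonal u σ τ black) ⟩
    h (u ⊕ diagonal σ τ) + + 2 * + n                  ≤⟨ ℤ.+-monoˡ-≤ _ (diagonal-≤ u black σ τ) ⟩
    h u + + 2 + + 2 * + n                             ≡⟨ collect (h u) (+ n) ⟩
    h u + + 2 * + suc n                               ∎
    where
    open ℤ.≤-Reasoning
    collect : ∀ a b → a + + 2 + + 2 * b ≡ a + + 2 * (1ℤ + b)
    collect = solve-∀

  -- The last `n` steps gain at most `2n`, so a total of `2(n+1)` leaves at least 2 for the first
  -- step.
  saturated⇒steep : ∀ σ τ n u → Black u →
    h (u ⊕ (+ suc n) ⊙ diagonal σ τ) ≡ h u + + 2 * + suc n →
    h u + + 2 ≤ h (u ⊕ diagonal σ τ)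
  saturated⇒steep σ τ n u black eq = begin
    h u + + 2                                                   ≡⟨ expand (h u) (+ n) ⟩
    h u + + 2 * + suc n - + 2 * + n                             ≡⟨ cong (_- + 2 * + n) eq ⟨
    h (u ⊕ (+ suc n) ⊙ diagonal σ τ) - + 2 * + n                ≡⟨
      cong (λ p → h p - + 2 * + n) (⊕-suc u n (diagonal σ τ)) ⟩
    h (u ⊕ diagonal σ τ ⊕ (+ n) ⊙ diagonal σ τ) - + 2 * + n     ≤⟨
      ℤ.+-monoˡ-≤ _ (diagonal-≤-iterate σ τ n (u ⊕ diagonal σ τ) (black-diagonal u σ τ black)) ⟩
    h (u ⊕ diagonal σ τ) + + 2 * + n - + 2 * + n                ≡⟨ cancel _ (+ 2 * + n) ⟩
    h (u ⊕ diagonal σ τ)                                        ∎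
    where
    open ℤ.≤-Reasoning
    expand : ∀ a b → a + + 2 ≡ a + + 2 * (1ℤ + b) - + 2 * b
    expand = solve-∀
    cancel : ∀ a b → a + b - b ≡ a
    cancel = solve-∀

  -- Paths of steepest ascent in a tiling without flips

  -- What is kept of `k` diagonal steps that each gain 2: the total rise and a bound on the
  -- displacement in sup norm, which is all that the comparison with the flux uses.
  Ascent : ℕ → ℤ² → ℤ² → Set
  Ascent k p q = ∃[ d ]
    q ≡ p ⊕ d × ∣ proj₁ d ∣ ℕ.≤ k × ∣ proj₂ d ∣ ℕ.≤ k × h q ≡ h p + + 2 * + k

  ascent-suc : ∀ {k p q} σ τ → Ascent k p q → h (q ⊕ diagonal σ τ) ≡ h q + + 2 →
    Ascent (suc k) p (q ⊕ diagonal σ τ)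
  ascent-suc {k} {p} {q} σ τ ((a , b) , eq , a≤k , b≤k , hq) rise =
    (a , b) ⊕ diagonal σ τ ,
    trans (cong (_⊕ diagonal σ τ) eq) (⊕-assoc p _ _) ,
    bound a σ a≤k , bound b τ b≤k ,
    trans rise (trans (cong (_+ + 2) hq) (collect (h p) (+ k)))
    where
    bound : ∀ a σ → ∣ a ∣ ℕ.≤ k → ∣ a + (σ ◃ 1) ∣ ℕ.≤ suc k
    bound a σ a≤k = begin
      ∣ a + (σ ◃ 1) ∣             ≤⟨ ℤ.∣i+j∣≤∣i∣+∣j∣ a (σ ◃ 1) ⟩
      ∣ a ∣ ℕ.+ ∣ σ ◃ 1 ∣         ≡⟨ cong (∣ a ∣ ℕ.+_) (ℤ.abs-◃ σ 1) ⟩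
      ∣ a ∣ ℕ.+ 1                 ≤⟨ ℕ.+-monoˡ-≤ 1 a≤k ⟩
      k ℕ.+ 1                     ≡⟨ ℕ.+-comm k 1 ⟩
      suc k                       ∎
      where open ℕ.≤-Reasoning
    collect : ∀ a b → a + + 2 * b + + 2 ≡ a + + 2 * (1ℤ + b)
    collect = solve-∀

  module _ (¬flip : ¬ AdmitsFlip t) where

    path : ℕ → Σ[ u ∈ ℤ² ] Black u
    path zero    = origin , ℕ.divides 0 refl
    path (suc n) =
      let u , black = path n
          σ , τ , _ = climb u black ¬flip
      in u ⊕ diagonal σ τ , black-diagonal u σ τ black

    path-ascent : ∀ k i → Ascent k (proj₁ (path i)) (proj₁ (path (k ℕ.+ i)))
    path-ascent zero i = origin , sym (⊕-identityʳ _) , ℕ.z≤n , ℕ.z≤n , sym (ℤ.+-identityʳ _)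
    path-ascent (suc k) i =
      let u , black = path (k ℕ.+ i)
          σ , τ , rise = climb u black ¬flip
      in ascent-suc σ τ (path-ascent k i) rise

-- Residues and multiples of the determinant in a lattice

%-≡⇒multiple : ∀ D .{{_ : NonZero D}} x y → x % D ≡ y % D → ∃[ q ] y ≡ x + q * D
%-≡⇒multiple D x y eq = y / D - x / D , (begin
  y                                                      ≡⟨ ℤ.a≡a%n+[a/n]*n y D ⟩
  + (y % D) + y / D * D                                  ≡⟨ cong (λ r → + r + y / D * D) eq ⟨
  + (x % D) + y / D * D                                  ≡⟨ shift (+ (x % D)) (x / D) (y / D) D ⟩
  + (x % D) + x / D * D + (y / D - x / D) * D            ≡⟨ cong (_+ (y / D - x / D) * D) (ℤ.a≡a%n+[a/n]*n x D) ⟨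
  x + (y / D - x / D) * D                                ∎)
  where
  open ≡-Reasoning
  shift : ∀ r p q D → r + q * D ≡ r + p * D + (q - p) * D
  shift = solve-∀

-- There are `∣ D ∣` squared pairs of residues, and the pigeonhole principle is applied to one more
-- point than that.
repeated-residue : ∀ D .{{_ : NonZero D}} (p : ℕ → ℤ²) →
  ∃₂ λ k i → ∃₂ λ a b → p (suc k ℕ.+ i) ≡ p i ⊕ (a * D , b * D)
repeated-residue D p with Fin.pigeonhole (ℕ.n<1+n (∣ D ∣ ℕ.* ∣ D ∣)) (residue ∘ p ∘ toℕ)
  where
  residue : ℤ² → Fin (∣ D ∣ ℕ.* ∣ D ∣)
  residue (x , y) = combine (fromℕ< (ℤ.n%d<d x D)) (fromℕ< (ℤ.n%d<d y D))
... | i , j , i<j , eq =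
  let x , y   = p (toℕ i)
      x′ , y′ = p (toℕ j)
      eq₁ , eq₂ = Fin.combine-injective
        (fromℕ< (ℤ.n%d<d x D)) (fromℕ< (ℤ.n%d<d y D)) (fromℕ< (ℤ.n%d<d x′ D)) _ eq
      a , x-eq = %-≡⇒multiple D x x′ (Fin.fromℕ<-injective _ _ _ _ eq₁)
      b , y-eq = %-≡⇒multiple D y y′ (Fin.fromℕ<-injective _ _ _ _ eq₂)
  in k , toℕ i , a , b , trans (cong p k+i≡j) (cong₂ _,_ x-eq y-eq)
  where
  -- One less than the distance between the indices, since the loop has length `suc k` and so is
  -- never empty.
  k = toℕ j ℕ.∸ suc (toℕ i)
  k+i≡j : suc k ℕ.+ toℕ i ≡ toℕ j
  k+i≡j = trans (sym (ℕ.+-suc k (toℕ i))) (ℕ.m∸n+n≡m i<j)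

det : ℤ² → ℤ² → ℤ
det (a , b) (c , d) = a * d - b * c

-- If the determinant vanished, the rows of the adjugate would give two relations between `v` and
-- `w`; independence makes their coefficients `a` and `b` zero, so that `v` is zero, which is
-- absurd.
det≢0 : ∀ v w → LinearlyIndependent v w → det v w ≢ 0ℤ
det≢0 v@(a , b) w@(c , d) independent D≡0 = contradiction (proj₁ (independent 1ℤ 0ℤ trivial)) λ ()
  where
  first : d ⊙ v ⊕ (- b) ⊙ w ≡ origin
  first = cong₂ _,_ (trans (eq₁ a b c d) D≡0) (eq₂ b d)
    where
    eq₁ : ∀ a b c d → d * a + (- b) * c ≡ a * d - b * c
    eq₁ = solve-∀
    eq₂ : ∀ b d → d * b + (- b) * d ≡ 0ℤ
    eq₂ = solve-∀
  second : (- c) ⊙ v ⊕ a ⊙ w ≡ origin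
  second = cong₂ _,_ (eq₁ a c) (trans (eq₂ a b c d) D≡0)
    where
    eq₁ : ∀ a c → (- c) * a + a * c ≡ 0ℤ
    eq₁ = solve-∀
    eq₂ : ∀ a b c d → (- c) * b + a * d ≡ a * d - b * c
    eq₂ = solve-∀
  b≡0 : b ≡ 0ℤ
  b≡0 = ℤ.neg-injective (proj₂ (independent d (- b) first))
  a≡0 : a ≡ 0ℤ
  a≡0 = proj₂ (independent (- c) a second)
  trivial : 1ℤ ⊙ v ⊕ 0ℤ ⊙ w ≡ origin
  trivial = cong₂ _,_ (cong (λ a → 1ℤ * a + 0ℤ) a≡0) (cong (λ b → 1ℤ * b + 0ℤ) b≡0)

-- Cramer's rule without the division: the coefficients in the basis `v`, `w` are integers once the
-- target is multiplied by the determinant.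
det-multiples : ∀ {L} v w → GeneratedBy v w L → ∀ k l → (k * det v w , l * det v w) ∈ L
det-multiples v@(a , b) w@(c , d) generated k l =
  Equivalence.from (generated _)
    (k * d - l * c , l * a - k * b , cong₂ _,_ (eq₁ a b c d k l) (eq₂ a b c d k l))
  where
  eq₁ : ∀ a b c d k l → k * (a * d - b * c) ≡ (k * d - l * c) * a + (l * a - k * b) * c
  eq₁ = solve-∀
  eq₂ : ∀ a b c d k l → l * (a * d - b * c) ≡ (k * d - l * c) * b + (l * a - k * b) * d
  eq₂ = solve-∀

positive-multiple : ∀ i → i ≢ 0ℤ → ∃₂ λ m ε → + suc m ≡ ε * i
positive-multiple (+ zero)  i≢0 = contradiction refl i≢0
positive-multiple (+ suc n) _   = n , 1ℤ , sym (ℤ.*-identityˡ (+ suc n))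
positive-multiple -[1+ n ]  _   = n , -1ℤ , sym (ℤ.-1*i≡-i -[1+ n ])

-- Integers among the rationals, and the pairing with the flux

-- In unnormalised form the denominator is literally 1, so order and arithmetic of `fromℤ` reduce to
-- those of the integers.
toℚᵘ-fromℤ : ∀ n → toℚᵘ (fromℤ n) ℚᵘ.≃ mkℚᵘ n 0
toℚᵘ-fromℤ n = ℚ.toℚᵘ-fromℚᵘ (mkℚᵘ n 0)

fromℤ-injective : ∀ {m n} → fromℤ m ≡ fromℤ n → m ≡ n
fromℤ-injective {m} {n} eq
  with *≡* m*1≡n*1 ← ℚᵘ.≃-trans (ℚᵘ.≃-sym (toℚᵘ-fromℤ m)) (ℚᵘ.≃-trans (ℚ.toℚᵘ-cong eq) (toℚᵘ-fromℤ n))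
  = ℤ.*-cancelʳ-≡ m n 1ℤ m*1≡n*1

fromℤ-mono-≤ : ∀ {m n} → m ≤ n → fromℤ m ℚ.≤ fromℤ n
fromℤ-mono-≤ {m} {n} m≤n = ℚ.toℚᵘ-cancel-≤ (ℚᵘ.≤-respˡ-≃ (ℚᵘ.≃-sym (toℚᵘ-fromℤ m))
  (ℚᵘ.≤-respʳ-≃ (ℚᵘ.≃-sym (toℚᵘ-fromℤ n)) (*≤* (ℤ.*-monoʳ-≤-nonNeg 1ℤ m≤n))))

fromℤ-* : ∀ m n → fromℤ (m * n) ≡ fromℤ m ℚ.* fromℤ n
fromℤ-* m n = ℚ.toℚᵘ-injective (ℚᵘ.≃-trans (toℚᵘ-fromℤ (m * n)) (ℚᵘ.≃-sym
  (ℚᵘ.≃-trans (ℚ.toℚᵘ-homo-* (fromℤ m) (fromℤ n)) (ℚᵘ.*-cong (toℚᵘ-fromℤ m) (toℚᵘ-fromℤ n)))))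

∣fromℤ∣ : ∀ n → ℚ.∣ fromℤ n ∣ ≡ fromℤ (+ ∣ n ∣)
∣fromℤ∣ n = ℚ.toℚᵘ-injective (ℚᵘ.≃-trans (ℚ.toℚᵘ-homo-∣-∣ (fromℤ n))
  (ℚᵘ.≃-trans (ℚᵘ.∣-∣-cong (toℚᵘ-fromℤ n)) (ℚᵘ.≃-sym (toℚᵘ-fromℤ (+ ∣ n ∣)))))

p≤∣p∣ : ∀ p → p ℚ.≤ ℚ.∣ p ∣
p≤∣p∣ p with ℚ.≤-total ℚ.0ℚ p
... | inj₁ 0≤p = ℚ.≤-reflexive (sym (ℚ.0≤p⇒∣p∣≡p 0≤p))
... | inj₂ p≤0 = ℚ.≤-trans p≤0 (ℚ.0≤∣p∣ p)

sign-of : ∀ x → ∃[ σ ] x ℚ.* fromℤ (σ ◃ 1) ≡ ℚ.∣ x ∣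
sign-of x with ℚ.∣p∣≡p∨∣p∣≡-p x
... | inj₁ eq = Sign.+ , trans (ℚ.*-identityʳ x) (sym eq)
... | inj₂ eq = Sign.- , trans (trans (ℚ.*-comm x _) (sym (ℚ.neg-distribˡ-* ℚ.1ℚ x)))
  (trans (cong ℚ.-_ (ℚ.*-identityˡ x)) (sym eq))

∥_∥₁ : ℚ² → ℚ
∥ x , y ∥₁ = ℚ.∣ x ∣ ℚ.+ ℚ.∣ y ∣

-- The signs are those of the coordinates of `φ`: along this diagonal the bound of `pairing-≤` is
-- attained.
pairing-diagonal : ∀ φ → ∃₂ λ σ τ → ∀ n → ⟨ φ , n ⊙ diagonal σ τ ⟩ ≡ ∥ φ ∥₁ ℚ.* fromℤ n
pairing-diagonal (x , y) = σ , τ , λ n → begin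
  x ℚ.* fromℤ (n * (σ ◃ 1)) ℚ.+ y ℚ.* fromℤ (n * (τ ◃ 1))  ≡⟨ cong₂ ℚ._+_ (term x σ n x-eq) (term y τ n y-eq) ⟩
  ℚ.∣ x ∣ ℚ.* fromℤ n ℚ.+ ℚ.∣ y ∣ ℚ.* fromℤ n              ≡⟨ ℚ.*-distribʳ-+ (fromℤ n) ℚ.∣ x ∣ ℚ.∣ y ∣ ⟨
  (ℚ.∣ x ∣ ℚ.+ ℚ.∣ y ∣) ℚ.* fromℤ n                        ∎
  where
  open ≡-Reasoning
  σ = proj₁ (sign-of x)
  τ = proj₁ (sign-of y)
  x-eq = proj₂ (sign-of x)
  y-eq = proj₂ (sign-of y)
  term : ∀ x σ n → x ℚ.* fromℤ (σ ◃ 1) ≡ ℚ.∣ x ∣ → x ℚ.* fromℤ (n * (σ ◃ 1)) ≡ ℚ.∣ x ∣ ℚ.* fromℤ n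
  term x σ n eq = begin
    x ℚ.* fromℤ (n * (σ ◃ 1))                ≡⟨ cong (λ m → x ℚ.* fromℤ m) (ℤ.*-comm n (σ ◃ 1)) ⟩
    x ℚ.* fromℤ ((σ ◃ 1) * n)                ≡⟨ cong (x ℚ.*_) (fromℤ-* (σ ◃ 1) n) ⟩
    x ℚ.* (fromℤ (σ ◃ 1) ℚ.* fromℤ n)        ≡⟨ ℚ.*-assoc x _ _ ⟨
    x ℚ.* fromℤ (σ ◃ 1) ℚ.* fromℤ n          ≡⟨ cong (ℚ._* fromℤ n) eq ⟩
    ℚ.∣ x ∣ ℚ.* fromℤ n                      ∎

-- Hölder's inequality for the dual pair of the sum norm and the sup norm.
pairing-≤ : ∀ φ v {k} → ∣ proj₁ v ∣ ℕ.≤ k → ∣ proj₂ v ∣ ℕ.≤ k →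
  ⟨ φ , v ⟩ ℚ.≤ ∥ φ ∥₁ ℚ.* fromℤ (+ k)
pairing-≤ (x , y) (a , b) {k} a≤k b≤k = ℚ.≤-trans (ℚ.+-mono-≤ (term x a a≤k) (term y b b≤k))
  (ℚ.≤-reflexive (sym (ℚ.*-distribʳ-+ (fromℤ (+ k)) ℚ.∣ x ∣ ℚ.∣ y ∣)))
  where
  term : ∀ x a → ∣ a ∣ ℕ.≤ k → x ℚ.* fromℤ a ℚ.≤ ℚ.∣ x ∣ ℚ.* fromℤ (+ k)
  term x a a≤k = begin
    x ℚ.* fromℤ a                     ≤⟨ p≤∣p∣ _ ⟩
    ℚ.∣ x ℚ.* fromℤ a ∣               ≡⟨ ℚ.∣p*q∣≡∣p∣*∣q∣ x (fromℤ a) ⟩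
    ℚ.∣ x ∣ ℚ.* ℚ.∣ fromℤ a ∣         ≡⟨ cong (ℚ.∣ x ∣ ℚ.*_) (∣fromℤ∣ a) ⟩
    ℚ.∣ x ∣ ℚ.* fromℤ (+ ∣ a ∣)       ≤⟨ ℚ.*-monoˡ-≤-nonNeg ℚ.∣ x ∣ {{ℚ.∣-∣-nonNeg x}} (fromℤ-mono-≤ (+≤+ a≤k)) ⟩
    ℚ.∣ x ∣ ℚ.* fromℤ (+ k)           ∎
    where open ℚ.≤-Reasoning

half-scale : ∀ n → fromℤ (+ 4) ℚ.* (½ ℚ.* fromℤ n) ≡ fromℤ (+ 2 * n)
-- The product of 4 and `½` computes to `fromℤ (+ 2)`, so only reassociation is left.
half-scale n = trans (sym (ℚ.*-assoc (fromℤ (+ 4)) ½ (fromℤ n))) (sym (fromℤ-* (+ 2) n))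

scale-cancel-≤ : ∀ k {p q} →
  fromℤ (+ 4) ℚ.* (p ℚ.* fromℤ (+ suc k)) ℚ.≤ fromℤ (+ 4) ℚ.* (q ℚ.* fromℤ (+ suc k)) → p ℚ.≤ q
scale-cancel-≤ k le = ℚ.*-cancelʳ-≤-pos (fromℤ (+ suc k)) {{ℚ.normalize-pos (suc k) 1}}
  (ℚ.*-cancelˡ-≤-pos (fromℤ (+ 4)) le)

-- Flux bounds and the boundary case

module Flux (L : Pred ℤ² 0ℓ) (valid : IsValidLattice L)
            (t : Pred Domino 0ℓ) (tiling : IsTiling t)
            (h : ℤ² → ℤ) (height : IsHeightFunction t h)
            (φ : ℚ²) (flux : IsFlux L h φ) where

  open Height t tiling h height

  period : ∃[ D ] D ≢ 0ℤ × (∀ k l → (k * D , l * D) ∈ L)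
  period =
    let v , w , _ , _ , independent , generated = valid
    in det v w , det≢0 v w independent , det-multiples v w generated

  -- Taking `suc m` to be the absolute value of the determinant serves all four diagonal directions
  -- at once.
  diagonal-period : ∃[ m ] ∀ σ τ → (+ suc m) ⊙ diagonal σ τ ∈ L
  diagonal-period with D , D≢0 , multiples ← period with m , ε , eq ← positive-multiple D D≢0 =
    m , λ σ τ → subst L (cong₂ _,_ (along-axis D ε eq σ) (along-axis D ε eq τ))
      (multiples ((σ ◃ 1) * ε) ((τ ◃ 1) * ε))
    where
    along-axis : ∀ {m} D ε → + suc m ≡ ε * D → ∀ σ → (σ ◃ 1) * ε * D ≡ + suc m * (σ ◃ 1)
    along-axis {m} D ε eq σ = begin
      (σ ◃ 1) * ε * D        ≡⟨ ℤ.*-assoc (σ ◃ 1) ε D ⟩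
      (σ ◃ 1) * (ε * D)      ≡⟨ cong ((σ ◃ 1) *_) eq ⟨
      (σ ◃ 1) * + suc m      ≡⟨ ℤ.*-comm (σ ◃ 1) (+ suc m) ⟩
      + suc m * (σ ◃ 1)      ∎
      where open ≡-Reasoning

  -- Direction and length are fixed before the base point `u`, so equality in the flux bound can be
  -- exploited at every even vertex.
  steepest : ∃₂ λ σ τ → ∃[ m ] ∀ u →
    fromℤ (+ 4) ℚ.* (∥ φ ∥₁ ℚ.* fromℤ (+ suc m)) ≡ fromℤ (h (u ⊕ (+ suc m) ⊙ diagonal σ τ) - h u)
  steepest =
    let σ , τ , eq   = pairing-diagonal φ
        m , periodic = diagonal-period
    in σ , τ , m , λ u →
      trans (cong (fromℤ (+ 4) ℚ.*_) (sym (eq (+ suc m)))) (flux _ (periodic σ τ) u)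

  ∥flux∥≤½ : ∥ φ ∥₁ ℚ.≤ ½
  ∥flux∥≤½ = let σ , τ , m , eq = steepest in scale-cancel-≤ m $ begin
    fromℤ (+ 4) ℚ.* (∥ φ ∥₁ ℚ.* fromℤ (+ suc m))                       ≡⟨ eq origin ⟩
    fromℤ (h (origin ⊕ (+ suc m) ⊙ diagonal σ τ) - h origin)           ≤⟨ fromℤ-mono-≤ (≤-shift (h origin)
      (diagonal-≤-iterate σ τ (suc m) origin (ℕ.divides 0 refl))) ⟩
    fromℤ (+ 2 * + suc m)                                              ≡⟨ half-scale (+ suc m) ⟨
    fromℤ (+ 4) ℚ.* (½ ℚ.* fromℤ (+ suc m))                            ∎
    where
    open ℚ.≤-Reasoning
    ≤-shift : ∀ {a} b {c} → a ≤ b + c → a - b ≤ c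
    ≤-shift {a} b {c} le = subst (a - b ≤_) (i+j-i≡j b c) (ℤ.+-monoˡ-≤ (- b) le)

  -- Norm `½` means a rise of `2(m+1)` over `m+1` diagonal steps from any even vertex, the largest
  -- possible, so every single step in that direction gains 2.
  boundary⇒no-flip : φ ∈ ∂Q → ¬ AdmitsFlip t
  boundary⇒no-flip φ∈∂Q = let σ , τ , m , eq = steepest in
    steep⇒no-flip σ τ λ u black →
      saturated⇒steep σ τ m u black $
        ≡-shift _ (h u) $ fromℤ-injective $ begin
          fromℤ (h (u ⊕ (+ suc m) ⊙ diagonal σ τ) - h u)   ≡⟨ eq u ⟨
          fromℤ (+ 4) ℚ.* (∥ φ ∥₁ ℚ.* fromℤ (+ suc m))
            ≡⟨ cong (λ s → fromℤ (+ 4) ℚ.* (s ℚ.* fromℤ (+ suc m))) φ∈∂Q ⟩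
          fromℤ (+ 4) ℚ.* (½ ℚ.* fromℤ (+ suc m))          ≡⟨ half-scale (+ suc m) ⟩
          fromℤ (+ 2 * + suc m)                            ∎
    where
    open ≡-Reasoning
    ≡-shift : ∀ a b {c} → a - b ≡ c → a ≡ b + c
    ≡-shift a b refl = cancel a b
      where
      cancel : ∀ a b → a ≡ b + (a - b)
      cancel = solve-∀

  rising-period⇒½≤∥flux∥ : ∀ k p v → v ∈ L → ∣ proj₁ v ∣ ℕ.≤ suc k → ∣ proj₂ v ∣ ℕ.≤ suc k →
    h (p ⊕ v) ≡ h p + + 2 * + suc k → ½ ℚ.≤ ∥ φ ∥₁
  rising-period⇒½≤∥flux∥ k p v v∈L v₁≤ v₂≤ rise = scale-cancel-≤ k $ begin
    fromℤ (+ 4) ℚ.* (½ ℚ.* fromℤ (+ suc k))            ≡⟨ half-scale (+ suc k) ⟩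
    fromℤ (+ 2 * + suc k)                              ≡⟨ cong fromℤ (i+j-i≡j (h p) (+ 2 * + suc k)) ⟨
    fromℤ (h p + + 2 * + suc k - h p)                  ≡⟨ cong (λ n → fromℤ (n - h p)) rise ⟨
    fromℤ (h (p ⊕ v) - h p)                            ≡⟨ flux v v∈L p ⟨
    fromℤ (+ 4) ℚ.* ⟨ φ , v ⟩                          ≤⟨
      ℚ.*-monoˡ-≤-nonNeg (fromℤ (+ 4)) (pairing-≤ φ v v₁≤ v₂≤) ⟩
    fromℤ (+ 4) ℚ.* (∥ φ ∥₁ ℚ.* fromℤ (+ suc k))       ∎
    where
    open ℚ.≤-Reasoning

  no-flip⇒½≤∥flux∥ : ¬ AdmitsFlip t → ½ ℚ.≤ ∥ φ ∥₁
  no-flip⇒½≤∥flux∥ ¬flip =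
    let D , D≢0 , multiples             = period
        k , i , a , b , recurs          = repeated-residue D {{≢-nonZero D≢0}} (proj₁ ∘ path ¬flip)
        p                               = proj₁ (path ¬flip i)
        -- The path gives `v` its size and its rise, while the repeated residue puts the same `v` in
        -- `L`.
        v , shifted , v₁≤ , v₂≤ , rise  = path-ascent ¬flip (suc k) i
        v≡aD,bD                         = ⊕-cancelˡ p (trans (sym shifted) recurs)
    in rising-period⇒½≤∥flux∥ k p v (subst L (sym v≡aD,bD) (multiples a b)) v₁≤ v₂≤
         (trans (cong h (sym shifted)) rise)

proposition6p2p2 : (L : Pred ℤ² 0ℓ) → IsValidLattice L →
    (t : Pred Domino 0ℓ) → IsTorusTiling L t →
    (h : ℤ² → ℤ) → IsHeightFunction t h →
    (φ : ℚ²) → IsFlux L h φ →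
    (¬ AdmitsFlip t) ⇔ (φ ∈ ∂Q)
proposition6p2p2 L valid t (tiling , _) h height φ flux = mk⇔
  -- The upper bound holds for every flux, so the absence of flips has to supply only the lower
  -- bound.
  (λ ¬flip → ℚ.≤-antisym ∥flux∥≤½ (no-flip⇒½≤∥flux∥ ¬flip))
  boundary⇒no-flip
  where open Flux L valid t tiling h height φ flux
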